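{- 1. There exists a bounded distributive lattice with two unary operations $\mathcal{A}=(A,1,0,\vee,\wedge,\neg,\sim)$, with $\sim$ a minimal negation and $\neg$ an intuitionistic negation, such that $\neg\neg\sim1\neq\sim1$. 2. There exists a $K_{im}$-algebra $\mathcal{A}=(A,1,0,\vee,\wedge,\neg,\sim)$ such that $\sim$ is not an intuitionistic negation.
   Context: On a bounded distributive lattice $(A,1,0,\vee,\wedge)$, a unary operation $n$ is a preminimal negation if $a\leq b\Rightarrow nb\leq na$, $na\wedge nb\leq n(a\vee b)$ and $n0=1$; a minimal negation if moreover $a\leq nna$ and $a\wedge b\leq c\Rightarrow a\wedge nc\leq nb$; an intuitionistic negation if moreover $a\wedge na\leq b$ for all $a,b$. A $K_{im}$-algebra is $(A,1,0,\vee,\wedge,\neg,\sim)$ with $(A,1,0,\vee,\wedge)$ a bounded distributive lattice, $\neg$ an intuitionistic negation, $\sim$ a minimal negation, and $\neg\neg\sim1=\sim1$. -}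

module Defs where

open import Algebra.Core using (Op₁; Op₂)
open import Algebra.Definitions using (_DistributesOverˡ_)
open import Level using (suc; _⊔_)
open import Relation.Binary.Core using (Rel)
open import Relation.Binary.Lattice using (BoundedLattice; DistributiveLattice)
open import Relation.Binary.Lattice.Structures using (IsBoundedLattice)

record BoundedDistributiveLattice c ℓ₁ ℓ₂ : Set (suc (c ⊔ ℓ₁ ⊔ ℓ₂)) where
  infix  4 _≈_ _≤_
  infixr 6 _∨_
  infixr 7 _∧_
  field
    Carrier          : Set c
    _≈_              : Rel Carrier ℓ₁
    _≤_              : Rel Carrier ℓ₂
    _∨_              : Op₂ Carrier
    _∧_              : Op₂ Carrier
    ⊤                : Carrier
    ⊥                : Carrier
    isBoundedLattice : IsBoundedLattice _≈_ _≤_ _∨_ _∧_ ⊤ ⊥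
    -- In a lattice the other three distributive laws follow from this one.
    ∧-distribˡ-∨     : _DistributesOverˡ_ _≈_ _∧_ _∨_

  boundedLattice : BoundedLattice c ℓ₁ ℓ₂
  boundedLattice = record { isBoundedLattice = isBoundedLattice }

  distributiveLattice : DistributiveLattice c ℓ₁ ℓ₂
  distributiveLattice = record
    { isDistributiveLattice = record
      { isLattice    = IsBoundedLattice.isLattice isBoundedLattice
      ; ∧-distribˡ-∨ = ∧-distribˡ-∨
      }
    }

-- Compatibility of n with _≈_ is not a field below: it follows from
-- antitonicity and the antisymmetry of _≤_.
module _ {c ℓ₁ ℓ₂} (L : BoundedDistributiveLattice c ℓ₁ ℓ₂) where
  open BoundedDistributiveLattice L

  record IsPreminimalNegation (n : Op₁ Carrier) : Set (c ⊔ ℓ₁ ⊔ ℓ₂) where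
    field
      antitone : ∀ a b → a ≤ b → n b ≤ n a
      ∧-≤-n∨   : ∀ a b → n a ∧ n b ≤ n (a ∨ b)
      n⊥≈⊤     : n ⊥ ≈ ⊤

  record IsMinimalNegation (n : Op₁ Carrier) : Set (c ⊔ ℓ₁ ⊔ ℓ₂) where
    field
      isPreminimalNegation : IsPreminimalNegation n
      a≤nna                : ∀ a → a ≤ n (n a)
      contraposition       : ∀ a b c → a ∧ b ≤ c → a ∧ n c ≤ n b

    open IsPreminimalNegation isPreminimalNegation public

  record IsIntuitionisticNegation (n : Op₁ Carrier) : Set (c ⊔ ℓ₁ ⊔ ℓ₂) where
    field
      isMinimalNegation : IsMinimalNegation n
      explosion         : ∀ a b → a ∧ n a ≤ b

    open IsMinimalNegation isMinimalNegation public

record KimAlgebra c ℓ₁ ℓ₂ : Set (suc (c ⊔ ℓ₁ ⊔ ℓ₂)) where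
  infix 8 ¬_ ∼_
  field
    boundedDistributiveLattice : BoundedDistributiveLattice c ℓ₁ ℓ₂

  open BoundedDistributiveLattice boundedDistributiveLattice public

  field
    ¬_                         : Op₁ Carrier
    ∼_                         : Op₁ Carrier
    ¬-isIntuitionisticNegation :
      IsIntuitionisticNegation boundedDistributiveLattice ¬_
    ∼-isMinimalNegation        : IsMinimalNegation boundedDistributiveLattice ∼_
    ¬¬∼⊤≈∼⊤                    : ¬ ¬ ∼ ⊤ ≈ ∼ ⊤

{-# OPTIONS --safe #-}

-- In a Heyting algebra a ↦ a ⇨ f is a minimal negation for every f, with
-- ∼ ⊤ ≈ f, and it is intuitionistic for f = ⊥.  On the three-element chain
-- 0 < 1 < 2 let ¬ be given by f = 0.  Taking f = 1 for ∼ refutes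
-- ¬ ¬ ∼ ⊤ ≈ ∼ ⊤, as ¬ ¬ 1 = 2; taking f = 2 gives a K_im-algebra in which ∼ is
-- constantly ⊤, hence not explosive.

module Submission where

open import Defs
open import Algebra.Core using (Op₁; Op₂)
import Algebra.Construct.NaturalChoice.Max as Max
import Algebra.Construct.NaturalChoice.Min as Min
open import Data.Bool.Base using (if_then_else_)
open import Data.Fin.Base using (zero; suc; fromℕ)
open import Data.Fin.Properties using (≤-decTotalOrder; ≤fromℕ)
open import Data.Nat.Base using (z≤n)
open import Data.Product using (Σ; _×_; _,_)
open import Data.Sum.Base using ([_,_]′)
open import Level using (0ℓ)
open import Relation.Binary.Bundles using (DecTotalOrder)
open import Relation.Binary.Definitions using (Maximum; Minimum)
open import Relation.Binary.Lattice using (HeytingAlgebra; Exponential)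
import Relation.Binary.Lattice.Properties.HeytingAlgebra as HeytingAlgebraProperties
import Relation.Binary.Lattice.Properties.MeetSemilattice as MeetSemilatticeProperties
open import Relation.Binary.PropositionalEquality using (refl)
open import Relation.Nullary using (yes; no; does; contradiction) renaming (¬_ to Not)

module RelativeNegation {c ℓ₁ ℓ₂} (H : HeytingAlgebra c ℓ₁ ℓ₂) where
  open HeytingAlgebra H
  open HeytingAlgebraProperties H
  open MeetSemilatticeProperties meetSemilattice using (∧-assoc; ∧-comm; ∧-monotonic)

  boundedDistributiveLattice : BoundedDistributiveLattice c ℓ₁ ℓ₂
  boundedDistributiveLattice = record
    { isBoundedLattice = isBoundedLattice
    ; ∧-distribˡ-∨     = ∧-distribˡ-∨
    }

  -- By residuation the claim becomes `(x ∧ (z ⇨ f)) ∧ y ≤ f`. Regrouping brings `x ∧ y` together;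
  -- it lies below `z`, so modus ponens with `z ⇨ f` applies.
  ⇨-contraposition : ∀ {x y z} f → x ∧ y ≤ z → x ∧ (z ⇨ f) ≤ y ⇨ f
  ⇨-contraposition f x∧y≤z = transpose-⇨
    (trans (∧-monotonic (reflexive (∧-comm _ _)) (HeytingAlgebra.refl H))
    (trans (reflexive (∧-assoc _ _ _)) (⇨-applyˡ x∧y≤z)))

  ⇨-isMinimalNegation : ∀ f → IsMinimalNegation boundedDistributiveLattice (_⇨ f)
  ⇨-isMinimalNegation f = record
    { isPreminimalNegation = record
      { antitone = λ _ _ → ⇨ˡ-contravariant
      ; ∧-≤-n∨   = λ a b → ⇨-distribˡ-∨-∧-≥ a b f
      ; n⊥≈⊤     = antisym (maximum _)
                     (transpose-⇨ (trans (x∧y≤y _ _) (minimum f)))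
      }
    ; a≤nna          = λ _ → swap-transpose-⇨ ⇨-eval
    ; contraposition = λ _ _ _ → ⇨-contraposition f
    }

  ¬-isIntuitionisticNegation : IsIntuitionisticNegation boundedDistributiveLattice ¬_
  ¬-isIntuitionisticNegation = record
    { isMinimalNegation = ⇨-isMinimalNegation ⊥
    -- Modus ponens lands in `⊥`; this is where the choice `f = ⊥` matters.
    ; explosion         = λ a b → trans (⇨-applyʳ (HeytingAlgebra.refl H)) (minimum b)
    }

module BoundedChain {c ℓ₁ ℓ₂} (O : DecTotalOrder c ℓ₁ ℓ₂) where
  open DecTotalOrder O
  open Min totalOrder using (_⊓_; x⊓y≤x; x⊓y≤y; ⊓-glb; x≤y⇒x⊓y≈x; x≤y⇒y⊓x≈x)
  open Max totalOrder using (_⊔_; x≤x⊔y; x≤y⊔x; ⊔-lub)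

  module _ {⊤ ⊥ : Carrier} (maximum : Maximum _≤_ ⊤) (minimum : Minimum _≤_ ⊥) where

    -- Gödel implication, the residuum of the minimum on a bounded chain. It evaluates on concrete
    -- elements, so the facts about the three-element chain hold by computation.
    _⇨_ : Op₂ Carrier
    x ⇨ y = if does (x ≤? y) then ⊤ else y

    ⇨-exponential : Exponential _≤_ _⊓_ _⇨_
    ⇨-exponential w x y with x ≤? y
    ... | yes x≤y = (λ _ → maximum w) , (λ _ → trans (x⊓y≤y w x) x≤y)
    ... | no  x≰y = w≤y , trans (x⊓y≤x w x)
      where
      w≤y : w ⊓ x ≤ y → w ≤ y
      w≤y w⊓x≤y =
        -- On a chain `w ⊓ x` is `w` or `x`; the second case would give `x ≤ y`.
        [ (λ w≤x → ≤-respˡ-≈ (x≤y⇒x⊓y≈x w≤x) w⊓x≤y)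
        , (λ x≤w → contradiction (≤-respˡ-≈ (x≤y⇒y⊓x≈x x≤w) w⊓x≤y) x≰y)
        ]′ (total w x)

    heytingAlgebra : HeytingAlgebra c ℓ₁ ℓ₂
    heytingAlgebra = record
      { _∨_              = _⊔_
      ; _∧_              = _⊓_
      ; isHeytingAlgebra = record
        { isBoundedLattice = record
          { isLattice = record
            { isPartialOrder = isPartialOrder
            ; supremum       = λ x y → x≤x⊔y x y , x≤y⊔x x y , λ _ → ⊔-lub
            ; infimum        = λ x y → x⊓y≤x x y , x⊓y≤y x y , λ _ → ⊓-glb
            }
          ; maximum = maximum
          ; minimum = minimum
          }
        ; exponential = ⇨-exponential
        }
      }

-- The bounds are implicit: `≤fromℕ` fixes the top as `fromℕ 2`, and `z≤n` forces the bottom to be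
-- `zero`.
three : HeytingAlgebra 0ℓ 0ℓ 0ℓ
three = BoundedChain.heytingAlgebra (≤-decTotalOrder 3) ≤fromℕ (λ _ → z≤n)

proposition6p9 : (Σ (BoundedDistributiveLattice 0ℓ 0ℓ 0ℓ) λ L →
    let open BoundedDistributiveLattice L in
    Σ (Op₁ Carrier) λ ¬_ →
    Σ (Op₁ Carrier) λ ∼_ →
    IsMinimalNegation L ∼_ ×
    IsIntuitionisticNegation L ¬_ ×
    Not ((¬ (¬ (∼ ⊤))) ≈ (∼ ⊤)))
    ×
    (Σ (KimAlgebra 0ℓ 0ℓ 0ℓ) λ K →
    let open KimAlgebra K in
    Not (IsIntuitionisticNegation boundedDistributiveLattice ∼_))
proposition6p9 =
    ( boundedDistributiveLattice , (_⇨ ⊥) , (_⇨ suc zero)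
    -- With `∼ ⊤` equal to the middle element 1, `¬ 1` is 0 and `¬ 0` is 2, so `λ ()` refutes 2 = 1.
    , ⇨-isMinimalNegation (suc zero) , ¬-isIntuitionisticNegation , λ () )
  , ( record
        -- These two fields also determine the lattice, `¬_` and `∼_`, which are inferred.
        { ¬-isIntuitionisticNegation = ¬-isIntuitionisticNegation
        ; ∼-isMinimalNegation        = ⇨-isMinimalNegation ⊤
        ; ¬¬∼⊤≈∼⊤                    = refl
        }
    , λ ∼-isIntuitionistic →
        -- Since `∼ ⊤` is `⊤`, explosion at `⊤` and `⊥` would say 2 ≤ 0.
        contradiction (IsIntuitionisticNegation.explosion ∼-isIntuitionistic ⊤ ⊥) λ () )
  where
  open HeytingAlgebra three using (_⇨_; ⊤; ⊥)
  open RelativeNegation three
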